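{- For every integer $m\ge1$, the fan poset $P=\mathcal V(3,2,\ldots,2)$, where there are $m+1$ entries equal to $2$, is $m$-L-bounded but not $(m-1)$-L-bounded.
   Context: All posets are finite and nonempty. Let $[n]=\{1,\dots,n\}$; families of subsets of $[n]$ are ordered by inclusion. A poset $(P,\le)$ contains a poset $(P',\le')$ as a (weak) subposet if there is an injection $f:P'\to P$ such that $u\le' v$ implies $f(u)\le f(v)$. A family $\mathcal F\subseteq 2^{[n]}$ is $P$-free if it does not contain $P$ in this sense. $e(P)$ is the maximum integer $k\ge 0$ such that for all integers $n$ and $s$ the family $\binom{[n]}{s}\cup\binom{[n]}{s+1}\cup\cdots\cup\binom{[n]}{s+k-1}$ is $P$-free, where $\binom{[n]}{j}$ is the collection of $j$-element subsets of $[n]$ (empty if $j<0$ or $j>n$). The Lubell function of $\mathcal F\subseteq 2^{[n]}$ is the average over all $n!$ full (maximal) chains $\mathcal C$ of $2^{[n]}$ of $|\mathcal F\cap\mathcal C|$; equivalently $\bar h_n(\mathcal F)=\sum_{F\in\mathcal F}1/\binom{n}{|F|}$. For an integer $m\ge0$, $P$ is $m$-L-bounded if for all $n$, $\bar h_n(\mathcal F)\le e(P)$ for every $P$-free family $\mathcal F$ of subsets of $[n]$ all of whose members have sizes in $[m,n-m]$. Let $\mathcal P_\ell$ denote the chain with $\ell$ elements. For $\ell_1\ge\cdots\ge\ell_k\ge2$, the fan $\mathcal V(\ell_1,\ldots,\ell_k)$ is the poset obtained from disjoint chains $\mathcal P_{\ell_1},\ldots,\mathcal P_{\ell_k}$ by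 identifying their minimum elements (elements of different chains other than the common minimum are incomparable). -}

module Defs where

open import Data.Fin using (Fin; toℕ)
import Data.Fin as Fin
import Data.Fin.Properties as Fin
open import Data.Fin.Subset using (Subset; ⊥; _∪_; ⁅_⁆; ∣_∣)
open import Data.Fin.Subset.Properties using (_∈?_; ⊆-poset)
open import Data.Integer using (ℤ; +_)
import Data.Integer as ℤ
open import Data.List using (List; []; _∷_; [_]; allFin; concatMap; filter; map)
open import Data.Nat using (ℕ; zero; suc; pred; _+_; _≤_; _!)
open import Data.Nat.ListAction using (sum)
open import Data.Nat.Properties using (_!≢0)
open import Data.Product using (Σ-syntax; ∃-syntax; _×_; _,_; proj₁)
open import Data.Rational.Unnormalised using (ℚᵘ)
import Data.Rational.Unnormalised as ℚᵘ
open import Data.Vec using (Vec; _∷_; count; lookup)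
import Data.Vec as Vec
open import Function.Definitions using (Injective)
open import Level using (0ℓ)
open import Relation.Binary.Bundles using (Poset)
import Relation.Binary.Construct.On as On
open import Relation.Binary.Definitions using (Transitive; Antisymmetric)
open import Relation.Binary.Morphism.Structures using (IsOrderHomomorphism)
open import Relation.Binary.PropositionalEquality
  using (_≡_; refl; cong; isEquivalence)
open import Relation.Nullary using (¬_; ¬?)
open import Relation.Unary using (Pred; Decidable; _⊆_; ⋃)

-- Q contains P as a weak subposet.  (The stdlib's order monomorphisms also
-- reflect the order, which is not wanted here.)
_Contains_ : Poset 0ℓ 0ℓ 0ℓ → Poset 0ℓ 0ℓ 0ℓ → Set
Q Contains P =
  Σ[ f ∈ (P.Carrier → Q.Carrier) ]
    IsOrderHomomorphism P._≈_ Q._≈_ P._≤_ Q._≤_ f × Injective P._≈_ Q._≈_ f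
  where
  module P = Poset P
  module Q = Poset Q

-- The ground set [n] is modelled by Fin n.
Family : ℕ → Set₁
Family n = Pred (Subset n) 0ℓ

familyPoset : ∀ {n} → Family n → Poset 0ℓ 0ℓ 0ℓ
familyPoset {n} F = On.poset (⊆-poset n) (proj₁ {B = F})

Free : Poset 0ℓ 0ℓ 0ℓ → ∀ {n} → Family n → Set
Free P F = ¬ (familyPoset F Contains P)

-- All j-element subsets; j is an integer, so the layer is empty for j < 0.
Layer : ∀ {n} → ℤ → Family n
Layer j A = + ∣ A ∣ ≡ j

-- The layers of sizes s, s+1, …, s+k-1.
Layers : ∀ {n} → ℤ → ℕ → Family n
Layers s k = ⋃ (Fin k) λ i → Layer (s ℤ.+ + toℕ i)

AllLayersFree : Poset 0ℓ 0ℓ 0ℓ → ℕ → Set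
AllLayersFree P k = ∀ (n : ℕ) (s : ℤ) → Free P (Layers {n} s k)

-- "e(P) = k", as a relation.
e[_]≡_ : Poset 0ℓ 0ℓ 0ℓ → ℕ → Set
e[ P ]≡ k = AllLayersFree P k × (∀ k′ → AllLayersFree P k′ → k′ ≤ k)

-- All chains A = A₀ ⊂ A₁ ⊂ … ⊂ Aₖ in which each Aᵢ₊₁ adds one element to Aᵢ,
-- each chain listed exactly once.
chainsFrom : ∀ {n} (k : ℕ) → Subset n → List (Vec (Subset n) (suc k))
chainsFrom     zero    A = [ A ∷ Vec.[] ]
chainsFrom {n} (suc k) A =
  concatMap (λ i → map (A ∷_) (chainsFrom k (A ∪ ⁅ i ⁆)))
            (filter (λ i → ¬? (i ∈? A)) (allFin n))

-- A full chain of the Boolean lattice climbs from ∅ in n one-element steps.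
fullChains : ∀ n → List (Vec (Subset n) (suc n))
fullChains n = chainsFrom n ⊥

-- The average of ∣ F ∩ C ∣ over the n ! full chains C.
lubell : ∀ {n} {F : Family n} → Decidable F → ℚᵘ
lubell {n} F? = (+ sum (map (count F?) (fullChains n)) ℚᵘ./ (n !)) {{n !≢0}}

-- Sizes in [m , n - m]; the upper bound is written without subtraction.
SizesWithin : ∀ {n} → ℕ → Family n
SizesWithin {n} m A = m ≤ ∣ A ∣ × ∣ A ∣ + m ≤ n

-- Decidability of F makes it an ordinary (finite) set of subsets of [n].
-- The condition on k determines it uniquely, so k is e(P).
_-L-Bounded_ : ℕ → Poset 0ℓ 0ℓ 0ℓ → Set₁
m -L-Bounded P =
  ∃[ k ] e[ P ]≡ k ×
    (∀ (n : ℕ) (F : Family n) (F? : Decidable F) →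
       F ⊆ SizesWithin m → Free P F → lubell F? ℚᵘ.≤ + k ℚᵘ./ 1)

module _ {k : ℕ} (ℓs : Vec ℕ k) where

  -- The common minimum is min; node i j is the element of the i-th chain
  -- that is j+1 steps above it.
  data Fan : Set where
    min  : Fan
    node : (i : Fin k) → Fin (pred (lookup ℓs i)) → Fan

  data _≤ᶠ_ : Fan → Fan → Set where
    min≤  : ∀ {x} → min ≤ᶠ x
    chain : ∀ {i j j′} → j Fin.≤ j′ → node i j ≤ᶠ node i j′

  ≤ᶠ-reflexive : ∀ {x y} → x ≡ y → x ≤ᶠ y
  ≤ᶠ-reflexive {min}      refl = min≤
  ≤ᶠ-reflexive {node i j} refl = chain Fin.≤-refl

  ≤ᶠ-trans : Transitive _≤ᶠ_
  ≤ᶠ-trans min≤      _         = min≤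
  ≤ᶠ-trans (chain p) (chain q) = chain (Fin.≤-trans p q)

  ≤ᶠ-antisym : Antisymmetric _≡_ _≤ᶠ_
  ≤ᶠ-antisym min≤      min≤      = refl
  ≤ᶠ-antisym (chain p) (chain q) = cong (node _) (Fin.≤-antisym p q)

  -- 𝒱(ℓ₁, …, ℓₖ); intended for k ≥ 1 and all ℓᵢ ≥ 2.
  fan : Poset 0ℓ 0ℓ 0ℓ
  fan = record
    { Carrier        = Fan
    ; _≈_            = _≡_
    ; _≤_            = _≤ᶠ_
    ; isPartialOrder = record
      { isPreorder = record
        { isEquivalence = isEquivalence
        ; reflexive     = ≤ᶠ-reflexive
        ; trans         = ≤ᶠ-trans
        }
      ; antisym = ≤ᶠ-antisym
      }
    }

{-# OPTIONS --safe #-}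
-- Partition the full chains by their lowest member A of the family F.  If A is
-- not the bottom of a 3-chain in F, such a chain meets F at most twice.
-- Otherwise F, being P-free, has at most m + 2 members above A; with
-- N = n - ∣A∣, each lies on at most a fraction 1/N of the chains through A (as
-- m ≥ 1 excludes the full set), and N ≥ m + 2 because a 3-chain starts at A and
-- ends m levels below the top.  So the average is at most 1 + (m + 2)/N ≤ 2.
-- For sharpness, take n = 2m, all sets of sizes m - 1 and m and a single set of
-- size m + 1: an (m - 1)-set has only m + 1 + 1 supersets in this family.

module Submission where

open import Defs
import Algebra.Properties.CommutativeSemigroup as CommutativeSemigroup
import Data.Bool as Bool
open import Data.Fin using (Fin; zero; suc; toℕ)
import Data.Fin.Properties as Fin
open import Data.Fin.Subset
  using (Subset; inside; outside; _∈_; _∉_; _⊆_; _⊂_; ⊥; _∪_; _─_; ∁; ⁅_⁆; ∣_∣)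
open import Data.Fin.Subset.Properties
import Data.Integer as ℤ
import Data.Integer.Properties as ℤ
open import Data.List using (List; []; _∷_; _++_; allFin; concatMap; filter; length; map; tabulate)
open import Data.List.Properties using (map-++; map-∘; map-cong; map-cong-local)
open import Data.List.Relation.Unary.All using (All; []; _∷_)
import Data.List.Relation.Unary.All as All
open import Data.List.Relation.Unary.All.Properties using (all-filter)
open import Data.Nat using (ℕ; zero; suc; pred; _+_; _*_; _∸_; _!; _≤_; _<_; z≤n; s≤s)
open import Data.Nat.ListAction using (sum)
open import Data.Nat.ListAction.Properties using (sum-++)
open import Data.Nat.Properties
open import Data.Product using (∃-syntax; _×_; _,_; proj₁; proj₂)
import Data.Rational.Unnormalised as ℚᵘ
import Data.Rational.Unnormalised.Properties as ℚᵘ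
open import Data.Sum using (_⊎_; inj₁; inj₂; [_,_]′)
open import Data.Vec using (Vec; []; _∷_; count; here; there; lookup; replicate)
import Data.Vec as Vec
import Data.Vec.Membership.DecPropositional as DecMembership
open import Data.Vec.Membership.Propositional.Properties using (∈-lookup)
import Data.Vec.Properties as Vec
open import Data.Vec.Relation.Unary.All as Allᵛ using ([]; _∷_) renaming (All to Allᵛ)
import Data.Vec.Relation.Unary.All.Properties as Allᵛ
open import Data.Vec.Relation.Unary.AllPairs using ([]; _∷_)
open import Data.Vec.Relation.Unary.Any using (here; there)
open import Data.Vec.Relation.Unary.Unique.Propositional using (Unique)
open import Data.Vec.Relation.Unary.Unique.Propositional.Properties using (lookup-injective; tabulate⁺)
open import Function using (_∘_; id)
open import Level using (0ℓ)
open import Relation.Binary.Bundles using (Poset)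
open import Relation.Binary.Morphism.Structures using (IsOrderHomomorphism)
open import Relation.Binary.PropositionalEquality
open import Relation.Nullary
  using (¬_; ¬?; Dec; does; yes; no; contradiction; toSum; _×-dec_; _⊎-dec_)
open import Relation.Nullary.Decidable using (decidable-stable; dec-yes; dec-no)
open import Relation.Unary using (Pred; Decidable)

open CommutativeSemigroup +-commutativeSemigroup using (interchange)
open CommutativeSemigroup *-commutativeSemigroup using (x∙yz≈y∙xz)

private variable
  m n k : ℕ
  X : Set
  A B : Subset n

-- Inclusion and cardinality of finite subsets.

infix 4 _≟ˢ_
_≟ˢ_ : (A B : Subset n) → Dec (A ≡ B)
_≟ˢ_ = Vec.≡-dec Bool._≟_

⊆∧≢⇒⊂ : A ⊆ B → A ≢ B → A ⊂ B
⊆∧≢⇒⊂ {A = A} {B = B} A⊆B A≢B with A ⊂? B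
... | yes A⊂B = A⊂B
... | no  A⊄B = contradiction (⊆-antisym A⊆B B⊆A) A≢B
  where
  B⊆A : B ⊆ A
  B⊆A {x} x∈B = decidable-stable (x ∈? A) λ x∉A → A⊄B (A⊆B , x , x∈B , x∉A)

⊆∧∣≡∣⇒≡ : A ⊆ B → ∣ A ∣ ≡ ∣ B ∣ → A ≡ B
⊆∧∣≡∣⇒≡ {A = A} {B = B} A⊆B eq =
  decidable-stable (A ≟ˢ B) λ A≢B → <⇒≢ (p⊂q⇒∣p∣<∣q∣ (⊆∧≢⇒⊂ A⊆B A≢B)) eq

∣p∪⁅x⁆∣≡1+∣p∣ : ∀ (A : Subset n) {i} → i ∉ A → ∣ A ∪ ⁅ i ⁆ ∣ ≡ suc ∣ A ∣
∣p∪⁅x⁆∣≡1+∣p∣ (inside  ∷ A) {zero}  i∉A = contradiction here i∉A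
∣p∪⁅x⁆∣≡1+∣p∣ (outside ∷ A) {zero}  i∉A = cong (suc ∘ ∣_∣) (∪-identityʳ A)
∣p∪⁅x⁆∣≡1+∣p∣ (inside  ∷ A) {suc i} i∉A = cong suc (∣p∪⁅x⁆∣≡1+∣p∣ A (i∉A ∘ there))
∣p∪⁅x⁆∣≡1+∣p∣ (outside ∷ A) {suc i} i∉A = ∣p∪⁅x⁆∣≡1+∣p∣ A (i∉A ∘ there)

∣p∣+∣q─p∣≡∣q∣ : ∀ (A B : Subset n) → A ⊆ B → ∣ A ∣ + ∣ B ─ A ∣ ≡ ∣ B ∣
∣p∣+∣q─p∣≡∣q∣ []            []            _   = refl
∣p∣+∣q─p∣≡∣q∣ (inside  ∷ A) (outside ∷ B) A⊆B = contradiction (A⊆B here) λ ()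
∣p∣+∣q─p∣≡∣q∣ (inside  ∷ A) (inside  ∷ B) A⊆B = cong suc (∣p∣+∣q─p∣≡∣q∣ A B (drop-∷-⊆ A⊆B))
∣p∣+∣q─p∣≡∣q∣ (outside ∷ A) (inside  ∷ B) A⊆B =
  trans (+-suc _ _) (cong suc (∣p∣+∣q─p∣≡∣q∣ A B (drop-∷-⊆ A⊆B)))
∣p∣+∣q─p∣≡∣q∣ (outside ∷ A) (outside ∷ B) A⊆B = ∣p∣+∣q─p∣≡∣q∣ A B (drop-∷-⊆ A⊆B)

x∈p─q⇒x∉q : ∀ (p q : Subset n) {x} → x ∈ p ─ q → x ∉ q
x∈p─q⇒x∉q (_ ∷ p) (_ ∷ q) (there x∈p─q) (there x∈q) = x∈p─q⇒x∉q p q x∈p─q x∈q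

p∪⁅x⁆⊆q : A ⊆ B → ∀ {i} → i ∈ B → A ∪ ⁅ i ⁆ ⊆ B
p∪⁅x⁆⊆q {A = A} {B = B} A⊆B {i} i∈B x∈ =
  [ A⊆B , (λ x∈⁅i⁆ → subst (_∈ B) (sym (x∈⁅y⁆⇒x≡y i x∈⁅i⁆)) i∈B) ]′ (x∈p∪q⁻ A ⁅ i ⁆ x∈)

x∈p∪⁅x⁆ : ∀ (A : Subset n) i → i ∈ A ∪ ⁅ i ⁆
x∈p∪⁅x⁆ A i = q⊆p∪q A ⁅ i ⁆ (x∈⁅x⁆ i)

p∪⁅x⁆⊆q⇒p⊂q : ∀ {i} → i ∉ A → A ∪ ⁅ i ⁆ ⊆ B → A ⊂ B
p∪⁅x⁆⊆q⇒p⊂q {A = A} {i = i} i∉A A∪i⊆B =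
  ⊆-trans (p⊆p∪q ⁅ i ⁆) A∪i⊆B , i , A∪i⊆B (x∈p∪⁅x⁆ A i) , i∉A

∃-of-size : ∀ n {k} → k ≤ n → ∃[ A ] ∣_∣ {n} A ≡ k
∃-of-size n       z≤n       = ⊥ , ∣⊥∣≡0 n
∃-of-size (suc n) (s≤s k≤n) with A , refl ← ∃-of-size n k≤n = inside ∷ A , refl

-- Sums over lists.

sum-map-mono : ∀ {f g : X → ℕ} {xs} → All (λ x → f x ≤ g x) xs → sum (map f xs) ≤ sum (map g xs)
sum-map-mono []         = z≤n
sum-map-mono (le ∷ les) = +-mono-≤ le (sum-map-mono les)

sum-map-const : ∀ (xs : List X) c → sum (map (λ _ → c) xs) ≡ length xs * c
sum-map-const []       c = refl
sum-map-const (x ∷ xs) c = cong (c +_) (sum-map-const xs c)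

sum-map-+ : ∀ (f g : X → ℕ) xs →
            sum (map (λ x → f x + g x) xs) ≡ sum (map f xs) + sum (map g xs)
sum-map-+ f g []       = refl
sum-map-+ f g (x ∷ xs) = begin
  f x + g x + sum (map (λ x → f x + g x) xs)         ≡⟨ cong (f x + g x +_) (sum-map-+ f g xs) ⟩
  f x + g x + (sum (map f xs) + sum (map g xs))      ≡⟨ interchange (f x) (g x) _ _ ⟩
  f x + sum (map f xs) + (g x + sum (map g xs))      ∎
  where
  open ≡-Reasoning

sum-concatMap : ∀ {Y : Set} (g : Y → ℕ) (h : X → List Y) xs →
                sum (map g (concatMap h xs)) ≡ sum (map (λ x → sum (map g (h x))) xs)
sum-concatMap g h []       = refl
sum-concatMap g h (x ∷ xs) = begin
  sum (map g (h x ++ concatMap h xs))                  ≡⟨ cong sum (map-++ g (h x) _) ⟩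
  sum (map g (h x) ++ map g (concatMap h xs))          ≡⟨ sum-++ (map g (h x)) _ ⟩
  sum (map g (h x)) + sum (map g (concatMap h xs))     ≡⟨ cong (sum (map g (h x)) +_) (sum-concatMap g h xs) ⟩
  sum (map g (h x)) + sum (map (λ x → sum (map g (h x))) xs) ∎
  where open ≡-Reasoning

-- Induction reads the bits of `C` in step with the tabulation, which is why `g` is general: each
-- step replaces it by `g ∘ suc`. Indices in `C` must pass the filter; the others are dropped or
-- contribute zero.
sum-filter-tabulate : ∀ {P : Pred X 0ℓ} (P? : Decidable P) (g : Fin n → X) (f : X → ℕ) C {c} →
  (∀ {i} → i ∈ C → P (g i) × f (g i) ≡ c) → (∀ {i} → i ∉ C → P (g i) → f (g i) ≡ 0) →
  sum (map f (filter P? (tabulate g))) ≡ ∣ C ∣ * c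
sum-filter-tabulate P? g f [] on off = refl
sum-filter-tabulate P? g f (s ∷ C) on off
  with ih ← sum-filter-tabulate P? (g ∘ suc) f C (on ∘ there) (λ i∉C → off (i∉C ∘ λ { (there p) → p }))
  with P? (g zero) | s
... | yes p | inside  = cong₂ _+_ (proj₂ (on here)) ih
... | yes p | outside = cong₂ _+_ (off (λ ()) p) ih
... | no ¬p | inside  = contradiction (proj₁ (on here)) ¬p
... | no ¬p | outside = ih

-- Sums over the upper covers of a set.

nonMembers : Subset n → List (Fin n)
nonMembers {n} A = filter (λ i → ¬? (i ∈? A)) (allFin n)

all-nonMembers : ∀ (A : Subset n) → All (_∉ A) (nonMembers A)
all-nonMembers {n} A = all-filter (λ i → ¬? (i ∈? A)) (allFin n)

-- The sum over the upper covers of A in the Boolean lattice; opaque so that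
-- f and A can be inferred from ∑⋗ f A.
opaque
  ∑⋗ : (Subset n → ℕ) → Subset n → ℕ
  ∑⋗ f A = sum (map (λ i → f (A ∪ ⁅ i ⁆)) (nonMembers A))

  -- Two choices of `C` matter: the complement of `A`, when all covers have the same value, and
  -- `B ─ A`, when only the covers below a given `B` count.
  ∑⋗-uniform : ∀ (f : Subset n → ℕ) A C {c} →
    (∀ {i} → i ∈ C → i ∉ A × f (A ∪ ⁅ i ⁆) ≡ c) → (∀ {i} → i ∉ C → i ∉ A → f (A ∪ ⁅ i ⁆) ≡ 0) →
    ∑⋗ f A ≡ ∣ C ∣ * c
  ∑⋗-uniform f A = sum-filter-tabulate (λ i → ¬? (i ∈? A)) id (λ i → f (A ∪ ⁅ i ⁆))

  ∑⋗-mono : ∀ (f g : Subset n → ℕ) A → (∀ {i} → i ∉ A → f (A ∪ ⁅ i ⁆) ≤ g (A ∪ ⁅ i ⁆)) →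
            ∑⋗ f A ≤ ∑⋗ g A
  ∑⋗-mono f g A f≤g = sum-map-mono (All.map f≤g (all-nonMembers A))

  ∑⋗-cong : ∀ (f g : Subset n → ℕ) A → (∀ {i} → i ∉ A → f (A ∪ ⁅ i ⁆) ≡ g (A ∪ ⁅ i ⁆)) →
            ∑⋗ f A ≡ ∑⋗ g A
  ∑⋗-cong f g A f≡g =
    cong sum (map-cong-local (All.map f≡g (all-nonMembers A)))

  ∑⋗-+ : ∀ (f g : Subset n → ℕ) A → ∑⋗ (λ B → f B + g B) A ≡ ∑⋗ f A + ∑⋗ g A
  ∑⋗-+ f g A = sum-map-+ _ _ (nonMembers A)

  sum-chainsFrom : ∀ (g : Vec (Subset n) (suc (suc k)) → ℕ) A →
    sum (map g (chainsFrom (suc k) A)) ≡ ∑⋗ (λ B → sum (map (g ∘ (A ∷_)) (chainsFrom k B))) A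
  sum-chainsFrom {k = k} g A = trans
    (sum-concatMap g (λ i → map (A ∷_) (chainsFrom k (A ∪ ⁅ i ⁆))) (nonMembers A))
    (cong sum (map-cong (λ i → cong sum (sym (map-∘ (chainsFrom k (A ∪ ⁅ i ⁆))))) (nonMembers A)))

∑⋗-const : ∀ {A : Subset n} → ∣ A ∣ + k ≡ n → (f : Subset n → ℕ) → ∀ {c} →
           (∀ {i} → i ∉ A → f (A ∪ ⁅ i ⁆) ≡ c) → ∑⋗ f A ≡ k * c
∑⋗-const {k = k} {A = A} eq f {c} f≡c = begin
  ∑⋗ f A      ≡⟨ ∑⋗-uniform f A (∁ A) (λ i∈ → x∈∁p⇒x∉p i∈ , f≡c (x∈∁p⇒x∉p i∈))
                                      (λ i∉∁A i∉A → contradiction (x∉p⇒x∈∁p i∉A) i∉∁A) ⟩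
  ∣ ∁ A ∣ * c ≡⟨ cong (_* c) (trans (∣∁p∣≡n∸∣p∣ A) (trans (cong (_∸ ∣ A ∣) (sym eq)) (m+n∸m≡n ∣ A ∣ k))) ⟩
  k * c       ∎
  where open ≡-Reasoning

∑⋗-≤ : ∀ {A : Subset n} → ∣ A ∣ + k ≡ n → (f : Subset n → ℕ) → ∀ {c} →
       (∀ {i} → i ∉ A → f (A ∪ ⁅ i ⁆) ≤ c) → ∑⋗ f A ≤ k * c
∑⋗-≤ {k = k} {A = A} eq f {c} f≤c = begin
  ∑⋗ f A         ≤⟨ ∑⋗-mono f (λ _ → c) A f≤c ⟩
  ∑⋗ (λ _ → c) A ≡⟨ ∑⋗-const eq (λ _ → c) (λ _ → refl) ⟩
  k * c          ∎
  where open ≤-Reasoning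

-- Counting members of a family over chains

𝟙 : {P : Set} → Dec P → ℕ
𝟙 P? = Bool.if does P? then 1 else 0

𝟙-yes : {P : Set} (P? : Dec P) → P → 𝟙 P? ≡ 1
𝟙-yes P? p rewrite dec-yes P? p .proj₂ = refl

𝟙-no : {P : Set} (P? : Dec P) → ¬ P → 𝟙 P? ≡ 0
𝟙-no P? ¬p rewrite dec-no P? ¬p = refl

𝟙≤1 : {P : Set} (P? : Dec P) → 𝟙 P? ≤ 1
𝟙≤1 (yes _) = ≤-refl
𝟙≤1 (no _)  = z≤n

𝟙-⊎ : {P Q R : Set} (P? : Dec P) (Q? : Dec Q) (R? : Dec R) → (P → Q ⊎ R) → 𝟙 P? ≤ 𝟙 Q? + 𝟙 R?
𝟙-⊎ (no _)  _  _ _   = z≤n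
𝟙-⊎ (yes p) Q? R? imp with imp p
... | inj₁ q = ≤-trans (≤-reflexive (sym (𝟙-yes Q? q))) (m≤m+n _ _)
... | inj₂ r = ≤-trans (≤-reflexive (sym (𝟙-yes R? r))) (m≤n+m _ _)

𝟙-disjoint : {P Q R : Set} (P? : Dec P) (Q? : Dec Q) (R? : Dec R) →
             (Q → P) → (R → P) → (Q → ¬ R) → 𝟙 Q? + 𝟙 R? ≤ 𝟙 P?
𝟙-disjoint P? (no _)  (no _)  _   _   _   = z≤n
𝟙-disjoint P? (no _)  (yes r) _   R⇒P _   = ≤-reflexive (sym (𝟙-yes P? (R⇒P r)))
𝟙-disjoint P? (yes q) (no _)  Q⇒P _   _   = ≤-reflexive (sym (𝟙-yes P? (Q⇒P q)))
𝟙-disjoint P? (yes q) (yes r) _   _   dis = contradiction r (dis q)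

-- The number of members in F, summed over chainsFrom k A when ∣A∣ + k = n; the
-- factor suc k ! is the number of those chains.
chainSum : {F : Family n} → Decidable F → ℕ → Subset n → ℕ
chainSum F? zero    A = 𝟙 (F? A)
chainSum F? (suc k) A = 𝟙 (F? A) * suc k ! + ∑⋗ (chainSum F? k) A

private variable
  F G H : Family n

∪⁅⁆-height : ∀ {A : Subset n} {m i} → ∣ A ∣ + suc k ≡ m → i ∉ A → ∣ A ∪ ⁅ i ⁆ ∣ + k ≡ m
∪⁅⁆-height {k = k} {A = A} eq i∉A = trans (cong (_+ k) (∣p∪⁅x⁆∣≡1+∣p∣ A i∉A)) (trans (sym (+-suc ∣ A ∣ k)) eq)

-- `A` has one upper cover per missing element, so a chain has `k` choices for its first step, then
-- `k - 1`, and so on.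
sum-map-1-chainsFrom : ∀ {A : Subset n} k → ∣ A ∣ + k ≡ n → sum (map (λ _ → 1) (chainsFrom k A)) ≡ k !
sum-map-1-chainsFrom         zero    eq = refl
sum-map-1-chainsFrom {A = A} (suc k) eq = begin
  sum (map (λ _ → 1) (chainsFrom (suc k) A))             ≡⟨ sum-chainsFrom (λ _ → 1) A ⟩
  ∑⋗ (λ B → sum (map (λ _ → 1) (chainsFrom k B))) A
    ≡⟨ ∑⋗-const eq _ (λ i∉A → sum-map-1-chainsFrom k (∪⁅⁆-height eq i∉A)) ⟩
  suc k * k !                                            ∎
  where open ≡-Reasoning

length-chainsFrom : ∀ {A : Subset n} k → ∣ A ∣ + k ≡ n → length (chainsFrom k A) ≡ k !
length-chainsFrom {A = A} k eq = begin
  length (chainsFrom k A)                    ≡⟨ *-identityʳ _ ⟨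
  length (chainsFrom k A) * 1                ≡⟨ sum-map-const (chainsFrom k A) 1 ⟨
  sum (map (λ _ → 1) (chainsFrom k A))       ≡⟨ sum-map-1-chainsFrom k eq ⟩
  k !                                        ∎
  where open ≡-Reasoning

count-∷ : ∀ {F : Pred X 0ℓ} (F? : Decidable F) x (xs : Vec X k) → count F? (x ∷ xs) ≡ 𝟙 (F? x) + count F? xs
count-∷ F? x xs with does (F? x)
... | Bool.true  = refl
... | Bool.false = refl

-- Links the list of chains to the recursion used from here on. Splitting off `A` leaves `suc k`
-- covers with `k !` chains each, so `A` itself is counted `suc k !` times if it is in `F`.
chainSum-correct : ∀ {A : Subset n} (F? : Decidable F) → ∀ k → ∣ A ∣ + k ≡ n →
                   sum (map (count F?) (chainsFrom k A)) ≡ chainSum F? k A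
chainSum-correct {A = A} F? zero    eq = begin
  count F? (A ∷ []) + 0 ≡⟨ +-identityʳ _ ⟩
  count F? (A ∷ [])     ≡⟨ count-∷ F? A [] ⟩
  𝟙 (F? A) + 0          ≡⟨ +-identityʳ _ ⟩
  𝟙 (F? A)              ∎
  where open ≡-Reasoning
chainSum-correct {A = A} F? (suc k) eq = begin
  sum (map (count F?) (chainsFrom (suc k) A))
    ≡⟨ sum-chainsFrom (count F?) A ⟩
  ∑⋗ (λ B → sum (map (λ c → count F? (A ∷ c)) (chainsFrom k B))) A
    ≡⟨ ∑⋗-cong _ _ A step ⟩
  ∑⋗ (λ B → k ! * 𝟙 (F? A) + chainSum F? k B) A
    ≡⟨ ∑⋗-+ (λ _ → k ! * 𝟙 (F? A)) (chainSum F? k) A ⟩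
  ∑⋗ (λ B → k ! * 𝟙 (F? A)) A + ∑⋗ (chainSum F? k) A
    ≡⟨ cong (_+ ∑⋗ (chainSum F? k) A) (∑⋗-const eq _ (λ _ → refl)) ⟩
  suc k * (k ! * 𝟙 (F? A)) + ∑⋗ (chainSum F? k) A
    ≡⟨ cong (_+ ∑⋗ (chainSum F? k) A) (trans (sym (*-assoc (suc k) (k !) _)) (*-comm (suc k !) _)) ⟩
  𝟙 (F? A) * suc k ! + ∑⋗ (chainSum F? k) A ∎
  where
  open ≡-Reasoning
  step : ∀ {i} → i ∉ A → sum (map (λ c → count F? (A ∷ c)) (chainsFrom k (A ∪ ⁅ i ⁆))) ≡
                         k ! * 𝟙 (F? A) + chainSum F? k (A ∪ ⁅ i ⁆)
  step {i} i∉A = begin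
    sum (map (λ c → count F? (A ∷ c)) cs)              ≡⟨ cong sum (map-cong (count-∷ F? A) cs) ⟩
    sum (map (λ c → 𝟙 (F? A) + count F? c) cs)         ≡⟨ sum-map-+ (λ _ → 𝟙 (F? A)) (count F?) cs ⟩
    sum (map (λ _ → 𝟙 (F? A)) cs) + sum (map (count F?) cs)
      ≡⟨ cong₂ _+_ (trans (sum-map-const cs _) (cong (_* 𝟙 (F? A)) (length-chainsFrom k (∪⁅⁆-height eq i∉A))))
                   (chainSum-correct F? k (∪⁅⁆-height eq i∉A)) ⟩
    k ! * 𝟙 (F? A) + chainSum F? k (A ∪ ⁅ i ⁆)         ∎
    where cs = chainsFrom k (A ∪ ⁅ i ⁆)

chainSum-vanish : ∀ {A : Subset n} (F? : Decidable F) → ∀ k → ∣ A ∣ + k ≡ n → (∀ {B} → A ⊆ B → ¬ F B) →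
                  chainSum F? k A ≡ 0
chainSum-vanish {A = A} F? zero    eq F⇏ = 𝟙-no (F? A) (F⇏ id)
chainSum-vanish {A = A} F? (suc k) eq F⇏ = cong₂ _+_
  (cong (_* suc k !) (𝟙-no (F? A) (F⇏ id)))
  (trans (∑⋗-const eq (chainSum F? k)
    (λ i∉A → chainSum-vanish F? k (∪⁅⁆-height eq i∉A) (F⇏ ∘ ⊆-trans (p⊆p∪q _))))
    (*-zeroʳ (suc k)))

-- A union bound. The inclusion is asked only above `A`, since chains from `A` visit only supersets
-- of `A`.
chainSum-⊎ : (F? : Decidable F) (G? : Decidable G) (H? : Decidable H) → ∀ k A →
             (∀ {B} → A ⊆ B → F B → G B ⊎ H B) →
             chainSum F? k A ≤ chainSum G? k A + chainSum H? k A
chainSum-⊎ F? G? H? zero    A imp = 𝟙-⊎ (F? A) (G? A) (H? A) (imp id)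
chainSum-⊎ F? G? H? (suc k) A imp = begin
  𝟙 (F? A) * suc k ! + ∑⋗ (chainSum F? k) A
    ≤⟨ +-mono-≤ (*-monoˡ-≤ (suc k !) (𝟙-⊎ (F? A) (G? A) (H? A) (imp id)))
         (∑⋗-mono _ _ A (λ {i} _ → chainSum-⊎ F? G? H? k (A ∪ ⁅ i ⁆) (imp ∘ ⊆-trans (p⊆p∪q _)))) ⟩
  (𝟙 (G? A) + 𝟙 (H? A)) * suc k ! + ∑⋗ (λ B → chainSum G? k B + chainSum H? k B) A
    ≡⟨ cong₂ _+_ (*-distribʳ-+ (suc k !) (𝟙 (G? A)) _) (∑⋗-+ (chainSum G? k) (chainSum H? k) A) ⟩
  𝟙 (G? A) * suc k ! + 𝟙 (H? A) * suc k ! + (∑⋗ (chainSum G? k) A + ∑⋗ (chainSum H? k) A)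
    ≡⟨ interchange (𝟙 (G? A) * suc k !) _ _ _ ⟩
  chainSum G? (suc k) A + chainSum H? (suc k) A ∎
  where
  open ≤-Reasoning

-- The converse estimate to `chainSum-⊎`, for lower bounds: no set is counted twice when the two
-- subfamilies are disjoint.
chainSum-disjoint : (F? : Decidable F) (G? : Decidable G) (H? : Decidable H) → ∀ k A →
                    (∀ {B} → A ⊆ B → G B → F B) → (∀ {B} → A ⊆ B → H B → F B) →
                    (∀ {B} → A ⊆ B → G B → ¬ H B) →
                    chainSum G? k A + chainSum H? k A ≤ chainSum F? k A
chainSum-disjoint F? G? H? zero    A G⇒F H⇒F dis = 𝟙-disjoint (F? A) (G? A) (H? A) (G⇒F id) (H⇒F id) (dis id)
chainSum-disjoint F? G? H? (suc k) A G⇒F H⇒F dis = begin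
  chainSum G? (suc k) A + chainSum H? (suc k) A
    ≡⟨ interchange (𝟙 (G? A) * suc k !) _ _ _ ⟩
  𝟙 (G? A) * suc k ! + 𝟙 (H? A) * suc k ! + (∑⋗ (chainSum G? k) A + ∑⋗ (chainSum H? k) A)
    ≡⟨ cong₂ _+_ (*-distribʳ-+ (suc k !) (𝟙 (G? A)) _) (∑⋗-+ (chainSum G? k) (chainSum H? k) A) ⟨
  (𝟙 (G? A) + 𝟙 (H? A)) * suc k ! + ∑⋗ (λ B → chainSum G? k B + chainSum H? k B) A
    ≤⟨ +-mono-≤ (*-monoˡ-≤ (suc k !) (𝟙-disjoint (F? A) (G? A) (H? A) (G⇒F id) (H⇒F id) (dis id)))
         (∑⋗-mono _ _ A (λ {i} _ → chainSum-disjoint F? G? H? k (A ∪ ⁅ i ⁆)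
           (G⇒F ∘ ⊆-trans (p⊆p∪q _)) (H⇒F ∘ ⊆-trans (p⊆p∪q _)) (dis ∘ ⊆-trans (p⊆p∪q _)))) ⟩
  𝟙 (F? A) * suc k ! + ∑⋗ (chainSum F? k) A ∎
  where
  open ≤-Reasoning

-- Every chain upwards from A has at most h members in F.
Thin : ℕ → Family n → Subset n → Set
Thin zero    F A = ∀ {B} → A ⊆ B → ¬ F B
Thin (suc h) F A = ∀ {B i} → A ⊆ B → F B → i ∉ B → Thin h F (B ∪ ⁅ i ⁆)

Thin-⊆ : ∀ h → A ⊆ B → Thin h F A → Thin h F B
Thin-⊆ zero    A⊆B thin B⊆C = thin (⊆-trans A⊆B B⊆C)
Thin-⊆ (suc h) A⊆B thin B⊆C = thin (⊆-trans A⊆B B⊆C)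

-- There are `k !` chains, each with a budget of `h` members. If `A` is in `F` it uses one unit and
-- the covers inherit `h - 1`; otherwise they inherit the whole budget.
chainSum-thin : ∀ {A : Subset n} h (F? : Decidable F) k → ∣ A ∣ + k ≡ n → Thin h F A → chainSum F? k A ≤ h * k !
chainSum-thin zero    F? k eq thin = ≤-reflexive (chainSum-vanish F? k eq thin)
chainSum-thin (suc h) F? zero    eq thin = ≤-trans (𝟙≤1 (F? _)) (s≤s z≤n)
chainSum-thin {A = A} (suc h) F? (suc k) eq thin with F? A
... | no  _   = begin
  ∑⋗ (chainSum F? k) A     ≤⟨ ∑⋗-≤ eq _ (λ {i} i∉A → chainSum-thin (suc h) F? k (∪⁅⁆-height eq i∉A)
                                                     (Thin-⊆ (suc h) (p⊆p∪q ⁅ i ⁆) thin)) ⟩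
  suc k * (suc h * k !)    ≡⟨ x∙yz≈y∙xz (suc k) (suc h) (k !) ⟩
  suc h * (suc k * k !)    ∎
  where
  open ≤-Reasoning
... | yes A∈F = +-mono-≤ (≤-reflexive (*-identityˡ (suc k !))) (begin
  ∑⋗ (chainSum F? k) A     ≤⟨ ∑⋗-≤ eq _ (λ i∉A → chainSum-thin h F? k (∪⁅⁆-height eq i∉A) (thin id A∈F i∉A)) ⟩
  suc k * (h * k !)        ≡⟨ x∙yz≈y∙xz (suc k) h (k !) ⟩
  h * (suc k * k !)        ∎)
  where
  open ≤-Reasoning

-- Exact chain counts for maximal members, single sets and layers.

chainSum-maximal : ∀ {A : Subset n} (F? : Decidable F) → ∀ k → ∣ A ∣ + k ≡ n → F A → (∀ {B} → A ⊂ B → ¬ F B) →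
                   chainSum F? k A ≡ k !
chainSum-maximal {A = A} F? zero    eq A∈F max = 𝟙-yes (F? A) A∈F
chainSum-maximal {A = A} F? (suc k) eq A∈F max = begin
  𝟙 (F? A) * suc k ! + ∑⋗ (chainSum F? k) A
    ≡⟨ cong₂ _+_ (cong (_* suc k !) (𝟙-yes (F? A) A∈F))
         (trans (∑⋗-const eq _ λ i∉A → chainSum-vanish F? k (∪⁅⁆-height eq i∉A)
                  λ A∪i⊆B → max (p∪⁅x⁆⊆q⇒p⊂q i∉A A∪i⊆B))
                (*-zeroʳ (suc k))) ⟩
  1 * suc k ! + 0 ≡⟨ +-identityʳ _ ⟩
  1 * suc k !     ≡⟨ *-identityˡ (suc k !) ⟩
  suc k !         ∎
  where open ≡-Reasoning

-- A chain from `A` through `B` adds the `r` elements of `B ─ A` in some order and then the `s`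
-- remaining ones in some order.
chainSum-singleton : ∀ {A B : Subset n} r {s} → A ⊆ B → ∣ A ∣ + r ≡ ∣ B ∣ → ∣ B ∣ + s ≡ n →
                     chainSum (_≟ˢ B) (r + s) A ≡ r ! * s !
chainSum-singleton {A = A} {B = B} zero {s} A⊆B eq eqn
  with refl ← ⊆∧∣≡∣⇒≡ A⊆B (trans (sym (+-identityʳ ∣ A ∣)) eq) =
  trans (chainSum-maximal (_≟ˢ A) s eqn refl (λ A⊂B B≡A → ⊂-irref (sym B≡A) A⊂B)) (sym (+-identityʳ (s !)))
chainSum-singleton {n = n} {A = A} {B = B} (suc r) {s} A⊆B eq eqn = begin
  𝟙 (A ≟ˢ B) * suc (r + s) ! + ∑⋗ (chainSum (_≟ˢ B) (r + s)) A
    ≡⟨ cong (λ x → x * suc (r + s) ! + ∑⋗ (chainSum (_≟ˢ B) (r + s)) A) (𝟙-no (A ≟ˢ B) A≢B) ⟩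
  ∑⋗ (chainSum (_≟ˢ B) (r + s)) A
    ≡⟨ ∑⋗-uniform _ A (B ─ A) on off ⟩
  ∣ B ─ A ∣ * (r ! * s !)
    ≡⟨ cong (_* (r ! * s !)) (+-cancelˡ-≡ ∣ A ∣ _ _ (trans (∣p∣+∣q─p∣≡∣q∣ A B A⊆B) (sym eq))) ⟩
  suc r * (r ! * s !)
    ≡⟨ *-assoc (suc r) (r !) (s !) ⟨
  suc r ! * s ! ∎
  where
  open ≡-Reasoning
  A≢B : A ≢ B
  A≢B refl = m+1+n≢m ∣ A ∣ eq
  eqA : ∣ A ∣ + suc (r + s) ≡ n
  eqA = trans (sym (+-assoc ∣ A ∣ (suc r) s)) (trans (cong (_+ s) eq) eqn)
  on : ∀ {i} → i ∈ B ─ A → i ∉ A × chainSum (_≟ˢ B) (r + s) (A ∪ ⁅ i ⁆) ≡ r ! * s !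
  on i∈ = i∉A , chainSum-singleton r (p∪⁅x⁆⊆q A⊆B (p─q⊆p B A i∈)) (∪⁅⁆-height eq i∉A) eqn
    where i∉A = x∈p─q⇒x∉q B A i∈
  -- A chain whose first step adds an element outside `B` can no longer meet `B`.
  off : ∀ {i} → i ∉ B ─ A → i ∉ A → chainSum (_≟ˢ B) (r + s) (A ∪ ⁅ i ⁆) ≡ 0
  off {i} i∉B─A i∉A = chainSum-vanish (_≟ˢ B) (r + s) (∪⁅⁆-height eqA i∉A)
    λ { A∪i⊆B refl → i∉B─A (x∈p∧x∉q⇒x∈p─q (A∪i⊆B (x∈p∪⁅x⁆ A i)) i∉A) }

-- Every chain from a set of size at most `j` up to the full set meets layer `j` exactly once.
chainSum-layer : ∀ {A : Subset n} r {s j} → ∣ A ∣ + r ≡ j → j + s ≡ n →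
                 chainSum (λ B → ∣ B ∣ ≟ j) (r + s) A ≡ (r + s) !
chainSum-layer {A = A} zero {s} refl eqn rewrite +-identityʳ ∣ A ∣ =
  chainSum-maximal (λ B → ∣ B ∣ ≟ ∣ A ∣) s eqn refl λ A⊂B ∣B∣≡∣A∣ → <⇒≢ (p⊂q⇒∣p∣<∣q∣ A⊂B) (sym ∣B∣≡∣A∣)
chainSum-layer {n = n} {A = A} (suc r) {s} {j} eq eqn = begin
  𝟙 (∣ A ∣ ≟ j) * suc (r + s) ! + ∑⋗ (chainSum (λ B → ∣ B ∣ ≟ j) (r + s)) A
    ≡⟨ cong₂ (λ x y → x * suc (r + s) ! + y) (𝟙-no (∣ A ∣ ≟ j) (λ { refl → m+1+n≢m ∣ A ∣ eq }))
         (∑⋗-const eqA _ λ i∉A → chainSum-layer r (∪⁅⁆-height eq i∉A) eqn) ⟩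
  suc (r + s) ! ∎
  where
  open ≡-Reasoning
  eqA : ∣ A ∣ + suc (r + s) ≡ n
  eqA = trans (sym (+-assoc ∣ A ∣ (suc r) s)) (trans (cong (_+ s) eq) eqn)

∣⊥∣+n≡n : ∀ n → ∣ ⊥ {n} ∣ + n ≡ n
∣⊥∣+n≡n n = cong (_+ n) (∣⊥∣≡0 n)

chainSum-layer-⊥ : ∀ {j} → j ≤ n → chainSum {n} (λ B → ∣ B ∣ ≟ j) n ⊥ ≡ n !
chainSum-layer-⊥ {n = n} {j} j≤n =
  subst (λ k → chainSum {n} (λ B → ∣ B ∣ ≟ j) k ⊥ ≡ k !) (m+[n∸m]≡n j≤n)
    (chainSum-layer j (cong (_+ j) (∣⊥∣≡0 n)) (m+[n∸m]≡n j≤n))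

chainSum-singleton-⊥ : ∀ (B : Subset n) → chainSum (_≟ˢ B) n ⊥ ≡ ∣ B ∣ ! * (n ∸ ∣ B ∣) !
chainSum-singleton-⊥ {n = n} B =
  subst (λ k → chainSum (_≟ˢ B) k ⊥ ≡ ∣ B ∣ ! * (n ∸ ∣ B ∣) !) (m+[n∸m]≡n (∣p∣≤n B))
    (chainSum-singleton ∣ B ∣ (⊆-min B) (cong (_+ ∣ B ∣) (∣⊥∣≡0 n)) (m+[n∸m]≡n (∣p∣≤n B)))

-- With R = r + 1 and S = s + 1 this is R! S! ≤ (R + S - 1)!, that is, the binomial coefficient of R
-- + S over R is at least R + S whenever R and S are positive.
r!*s!≤[r+s∸1]! : ∀ r s → suc r ! * suc s ! ≤ suc (r + s) !
r!*s!≤[r+s∸1]! zero    s = ≤-reflexive (+-identityʳ _)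
r!*s!≤[r+s∸1]! (suc r) s = begin
  suc (suc r) ! * suc s !         ≡⟨ *-assoc (suc (suc r)) (suc r !) (suc s !) ⟩
  suc (suc r) * (suc r ! * suc s !) ≤⟨ *-mono-≤ (s≤s (s≤s (m≤m+n r s))) (r!*s!≤[r+s∸1]! r s) ⟩
  suc (suc r + s) !               ∎
  where open ≤-Reasoning

-- Chains through an explicit list of sets.

module _ {n : ℕ} where
  open DecMembership (_≟ˢ_ {n}) public using () renaming (_∈_ to _∈ᵛ_; _∈?_ to _∈ᵛ?_)

-- The fraction 1/N of the `N !` chains, with N = `suc k`. Since `B` lies strictly between `A` and
-- the full set, both its distances are positive, as the factorial inequality requires.
chainSum-interior : ∀ {A B : Subset n} → ∣ A ∣ + suc k ≡ n → A ⊂ B → ∣ B ∣ < n →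
                    chainSum (_≟ˢ B) (suc k) A ≤ k !
chainSum-interior {n = n} {k = k} {A = A} {B = B} eq A⊂B B<n
  with r , eqr ← m≤n⇒∃[o]m+o≡n (p⊂q⇒∣p∣<∣q∣ A⊂B)
  with s , eqs ← m≤n⇒∃[o]m+o≡n B<n = begin
  chainSum (_≟ˢ B) (suc k) A           ≡⟨ cong (λ x → chainSum (_≟ˢ B) x A) 1+k≡ ⟩
  chainSum (_≟ˢ B) (suc r + suc s) A   ≡⟨ chainSum-singleton (suc r) (p⊂q⇒p⊆q A⊂B) A+r B+s ⟩
  suc r ! * suc s !                    ≤⟨ r!*s!≤[r+s∸1]! r s ⟩
  suc (r + s) !                        ≡⟨ cong _! (trans (sym (+-suc r s)) (sym (cong pred 1+k≡))) ⟩
  k !                                  ∎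
  where
  open ≤-Reasoning
  A+r : ∣ A ∣ + suc r ≡ ∣ B ∣
  A+r = trans (+-suc _ _) eqr
  B+s : ∣ B ∣ + suc s ≡ n
  B+s = trans (+-suc _ _) eqs
  1+k≡ : suc k ≡ suc r + suc s
  1+k≡ = +-cancelˡ-≡ ∣ A ∣ _ _ (trans eq (sym (trans (sym (+-assoc ∣ A ∣ (suc r) (suc s)))
           (trans (cong (_+ suc s) A+r) B+s))))

chainSum-∈-≤ : ∀ {A : Subset n} {j} → ∣ A ∣ + suc k ≡ n → (Bs : Vec (Subset n) j) →
               Allᵛ (λ B → A ⊂ B × ∣ B ∣ < n) Bs → chainSum (_∈ᵛ? Bs) (suc k) A ≤ j * k !
chainSum-∈-≤ {k = k} eq [] [] = ≤-reflexive (chainSum-vanish (_∈ᵛ? []) (suc k) eq λ _ ())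
chainSum-∈-≤ {k = k} {A = A} eq (B ∷ Bs) ((A⊂B , B<n) ∷ rest) = ≤-trans
  (chainSum-⊎ (_∈ᵛ? (B ∷ Bs)) (_≟ˢ B) (_∈ᵛ? Bs) (suc k) A λ { _ (here eq) → inj₁ eq ; _ (there p) → inj₂ p })
  (+-mono-≤ (chainSum-interior eq A⊂B B<n) (chainSum-∈-≤ eq Bs rest))

-- Turns a number of sets into a number of chains: each cover of `A` lies on exactly `k !` chains
-- from `A`, and distinctness lets these counts be added.
chainSum-∈-covers : ∀ {A : Subset n} {j} → ∣ A ∣ + suc k ≡ n → (Bs : Vec (Subset n) j) → Unique Bs →
                    Allᵛ (λ B → A ⊆ B × ∣ B ∣ ≡ suc ∣ A ∣) Bs → j * k ! ≤ chainSum (_∈ᵛ? Bs) (suc k) A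
chainSum-∈-covers eq [] [] [] = z≤n
chainSum-∈-covers {k = k} {A = A} {suc j} eq (B ∷ Bs) (B∉Bs ∷ unique) ((A⊆B , ∣B∣≡) ∷ rest) = begin
  k ! + j * k !
    ≤⟨ +-mono-≤ (≤-reflexive (sym (trans (chainSum-singleton 1 A⊆B
         (trans (+-comm ∣ A ∣ 1) (sym ∣B∣≡)) (trans (cong (_+ k) ∣B∣≡) (trans (sym (+-suc _ k)) eq)))
         (*-identityˡ (k !)))))
       (chainSum-∈-covers eq Bs unique rest) ⟩
  chainSum (_≟ˢ B) (suc k) A + chainSum (_∈ᵛ? Bs) (suc k) A
    ≤⟨ chainSum-disjoint (_∈ᵛ? (B ∷ Bs)) (_≟ˢ B) (_∈ᵛ? Bs) (suc k) A (λ _ → here) (λ _ → there)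
         (λ { _ refl B∈Bs → Allᵛ.lookup B∉Bs B∈Bs refl }) ⟩
  chainSum (_∈ᵛ? (B ∷ Bs)) (suc k) A ∎
  where open ≤-Reasoning

-- Fans

-- Greedy search: unlisted members are added until there are `j` of them or none is left. The first
-- outcome will supply the leaves of a fan, the second a bound on the number of members.
enumerate : ∀ {Q : Family n} → Decidable Q → ∀ j →
  (∃[ Cs ] Unique {n = j} Cs × Allᵛ Q Cs) ⊎
  (∃[ l ] ∃[ Cs ] l < j × Allᵛ Q {l} Cs × (∀ {B} → Q B → B ∈ᵛ Cs))
enumerate Q? zero    = inj₁ ([] , [] , [])
enumerate Q? (suc j) with enumerate Q? j
... | inj₂ (l , Cs , l<j , all , cover) = inj₂ (l , Cs , m<n⇒m<1+n l<j , all , cover)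
... | inj₁ (Cs , unique , all) with anySubset? (λ B → Q? B ×-dec ¬? (B ∈ᵛ? Cs))
...   | yes (B , B∈Q , B∉Cs) = inj₁ (B ∷ Cs , B≢ ∷ unique , B∈Q ∷ all)
  where
  B≢ : Allᵛ (B ≢_) Cs
  B≢ = Allᵛ.lookup⁻ λ i B≡ → B∉Cs (subst (_∈ᵛ Cs) (sym B≡) (∈-lookup i Cs))
...   | no  ∄B = inj₂ (j , Cs , ≤-refl , all ,
          λ {B} B∈Q → decidable-stable (B ∈ᵛ? Cs) λ B∉Cs → ∄B (B , B∈Q , B∉Cs))

V : ℕ → Poset 0ℓ 0ℓ 0ℓ
V j = fan (3 ∷ replicate j 2)

-- The type is `Fin 1` for every `i`, but this only computes once `i` is fully known, hence the
-- induction.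
leaf-unique : ∀ (i : Fin k) (a b : Fin (pred (lookup (replicate k 2) i))) → a ≡ b
leaf-unique zero    zero zero = refl
leaf-unique (suc i) a    b    = leaf-unique i a b

-- The element of chain `i` that covers the minimum, found by the same induction on `i`.
bottom : ∀ j (i : Fin (suc j)) → Fin (pred (lookup (3 ∷ replicate j 2) i))
bottom j       zero          = zero
bottom (suc j) (suc zero)    = zero
bottom (suc j) (suc (suc i)) = bottom j (suc i)

-- Containment is weak, so the leaves `C i` need only lie above `A` and be distinct from `X`, `Y`
-- and each other.
contains-V : ∀ {j} (A X Y : Subset n) (C : Fin j → Subset n) →
  F A → F X → F Y → (∀ i → F (C i)) → A ⊂ X → X ⊂ Y → (∀ i → A ⊂ C i) →
  (∀ i → C i ≢ X) → (∀ i → C i ≢ Y) → (∀ {i i′} → C i ≡ C i′ → i ≡ i′) →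
  familyPoset F Contains V j
contains-V {F = F} {j = j} A X Y C A∈F X∈F Y∈F C∈F A⊂X X⊂Y A⊂C C≢X C≢Y C-inj =
  (λ u → f u , f∈F u) , record { cong = cong f ; mono = mono } , inj _ _
  where
  ℓs = 3 ∷ replicate j 2
  f : Fan ℓs → Subset _
  f min                   = A
  f (node zero zero)      = X
  f (node zero (suc _))   = Y
  f (node (suc i) _)      = C i
  f∈F : ∀ u → F (f u)
  f∈F min                 = A∈F
  f∈F (node zero zero)    = X∈F
  f∈F (node zero (suc _)) = Y∈F
  f∈F (node (suc i) _)    = C∈F i
  A⊂node : ∀ i a → A ⊂ f (node i a)
  A⊂node zero    zero    = A⊂X
  A⊂node zero    (suc _) = ⊂-trans A⊂X X⊂Y
  A⊂node (suc i) _       = A⊂C i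
  mono : ∀ {u v} → _≤ᶠ_ ℓs u v → f u ⊆ f v
  mono {v = min}      min≤ = id
  mono {v = node i a} min≤ = p⊂q⇒p⊆q (A⊂node i a)
  mono (chain {zero} {zero} {zero} _)          = id
  mono (chain {zero} {zero} {suc _} _)         = p⊂q⇒p⊆q X⊂Y
  mono (chain {zero} {suc _} {suc _} _)        = id
  mono (chain {suc i} _)                       = id
  inj : ∀ u v → f u ≡ f v → u ≡ v
  inj min                     min                     eq = refl
  inj min                     (node i a)              eq = contradiction (A⊂node i a) (⊂-irref eq)
  inj (node i a)              min                     eq = contradiction (A⊂node i a) (⊂-irref (sym eq))
  inj (node zero zero)        (node zero zero)        eq = refl
  inj (node zero zero)        (node zero (suc _))     eq = contradiction X⊂Y (⊂-irref eq)
  inj (node zero (suc _))     (node zero zero)        eq = contradiction X⊂Y (⊂-irref (sym eq))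
  inj (node zero (suc zero))  (node zero (suc zero))  eq = refl
  inj (node zero zero)        (node (suc i) _)        eq = contradiction (sym eq) (C≢X i)
  inj (node zero (suc _))     (node (suc i) _)        eq = contradiction (sym eq) (C≢Y i)
  inj (node (suc i) _)        (node zero zero)        eq = contradiction eq (C≢X i)
  inj (node (suc i) _)        (node zero (suc _))     eq = contradiction eq (C≢Y i)
  inj (node (suc i) a)        (node (suc i′) b)       eq
    with refl ← C-inj eq = cong (node (suc i)) (leaf-unique i a b)

module _ {n m : ℕ} {F : Family n} (emb : familyPoset F Contains V m) where

  private
    ℓs : Vec ℕ (suc m)
    ℓs = 3 ∷ replicate m 2

  image : Fan ℓs → Subset n
  image = proj₁ ∘ proj₁ emb

  image∈F : ∀ u → F (image u)
  image∈F = proj₂ ∘ proj₁ emb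

  image-⊂ : ∀ {u v} → _≤ᶠ_ ℓs u v → u ≢ v → image u ⊂ image v
  image-⊂ u≤v u≢v = ⊆∧≢⇒⊂ (IsOrderHomomorphism.mono (proj₁ (proj₂ emb)) u≤v) (u≢v ∘ proj₂ (proj₂ emb))

  image-< : ∀ {u v} → _≤ᶠ_ ℓs u v → u ≢ v → ∣ image u ∣ < ∣ image v ∣
  image-< u≤v u≢v = p⊂q⇒∣p∣<∣q∣ (image-⊂ u≤v u≢v)

  min<mid : ∣ image min ∣ < ∣ image (node zero zero) ∣
  min<mid = image-< min≤ λ ()

  mid<top : ∣ image (node zero zero) ∣ < ∣ image (node zero (suc zero)) ∣
  mid<top = image-< (chain z≤n) λ ()

-- The value of e for these fans.

-- The long branch is a 3-chain, whose sizes grow by at least two, while sizes in two consecutive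
-- layers differ by at most one.
layers-free : ∀ m → AllLayersFree (V m) 2
layers-free m n s emb = <-irrefl refl (ℤ.drop‿+≤+ (begin
  + suc (suc ∣bot∣)             ≤⟨ ℤ.+≤+ (<-≤-trans (s≤s (min<mid emb)) (mid<top emb)) ⟩
  + ∣top∣                       ≡⟨ proj₂ top∈ ⟩
  s ℤ.+ (+ toℕ (proj₁ top∈))    ≤⟨ ℤ.+-monoʳ-≤ s (ℤ.+≤+ (Fin.toℕ≤pred[n] (proj₁ top∈))) ⟩
  s ℤ.+ (+ 1)                   ≤⟨ ℤ.+-monoˡ-≤ (+ 1) (ℤ.i≤i+j s (+ toℕ (proj₁ bot∈))) ⟩
  s ℤ.+ (+ toℕ (proj₁ bot∈)) ℤ.+ (+ 1) ≡⟨ cong (ℤ._+ (+ 1)) (proj₂ bot∈) ⟨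
  (+ ∣bot∣) ℤ.+ (+ 1)           ≡⟨ cong +_ (+-comm ∣bot∣ 1) ⟩
  + suc ∣bot∣                   ∎))
  where
  open ℤ.≤-Reasoning
  open import Data.Integer using (+_)
  ∣bot∣ = ∣ image emb min ∣
  ∣top∣ = ∣ image emb (node zero (suc zero)) ∣
  bot∈ = image∈F emb min
  top∈ = image∈F emb (node zero (suc zero))

-- On m + 2 points take the empty set as minimum, one singleton below a pair as the long branch, and
-- the other m + 1 singletons as leaves.
layers-contain : ∀ m k → familyPoset (Layers {suc (suc m)} (ℤ.+ 0) (3 + k)) Contains V (suc m)
layers-contain m k = contains-V ⊥ ⁅ zero ⁆ (inside ∷ inside ∷ ⊥) (⁅_⁆ ∘ suc)
  (zero , cong ℤ.+_ (∣⊥∣≡0 (suc (suc m))))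
  (suc zero , cong ℤ.+_ (∣⁅x⁆∣≡1 {suc (suc m)} zero))
  (suc (suc zero) , cong (λ x → ℤ.+ suc (suc x)) (∣⊥∣≡0 m))
  (λ i → suc zero , cong ℤ.+_ (∣⁅x⁆∣≡1 (suc i)))
  (⊥⊂⁅⁆ zero)
  ((λ { here → here ; (there x∈⊥) → contradiction x∈⊥ ∉⊥ }) , suc zero , there here , λ { (there ()) })
  (⊥⊂⁅⁆ ∘ suc)
  (λ _ ()) (λ _ ())
  (λ {i} eq → Fin.suc-injective (x∈⁅y⁆⇒x≡y _ (subst (suc i ∈_) eq (x∈⁅x⁆ (suc i)))))
  where
  ⊥⊂⁅⁆ : ∀ {n} (i : Fin n) → ⊥ ⊂ ⁅ i ⁆
  ⊥⊂⁅⁆ i = ⊆-min _ , i , x∈⁅x⁆ i , ∉⊥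

e[V]≤2 : ∀ m k → AllLayersFree (V (suc m)) k → k ≤ 2
e[V]≤2 m 0 _ = z≤n
e[V]≤2 m 1 _ = s≤s z≤n
e[V]≤2 m 2 _ = ≤-refl
e[V]≤2 m (suc (suc (suc k))) free = contradiction (layers-contain m k) (free _ (ℤ.+ 0))

-- Upper bound for the Lubell function

module _ {n m : ℕ} {F : Family n} (F? : Decidable F) (1≤m : 1 ≤ m)
         (sizes : ∀ {B} → F B → SizesWithin m B) (free : Free (V (suc m)) F) where

  F⇒∣B∣<n : ∀ {B} → F B → ∣ B ∣ < n
  F⇒∣B∣<n {B} B∈F = begin-strict
    ∣ B ∣     <⟨ m<m+n ∣ B ∣ 1≤m ⟩
    ∣ B ∣ + m ≤⟨ proj₂ (sizes B∈F) ⟩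
    n         ∎
    where open ≤-Reasoning

  chainSum-above-3-chain : ∀ {A X Y} k → ∣ A ∣ + suc k ≡ n → F A → F X → F Y → A ⊂ X → X ⊂ Y →
                           chainSum F? (suc k) A ≤ 2 * suc k !
  chainSum-above-3-chain {A} {X} {Y} k eq A∈F X∈F Y∈F A⊂X X⊂Y
    -- The members above `A` other than `X` and `Y` are candidate leaves; m + 1 of them would
    -- complete a copy of the fan.
    with enumerate (λ B → A ⊂? B ×-dec F? B ×-dec ¬? (B ≟ˢ X) ×-dec ¬? (B ≟ˢ Y)) (suc m)
  ... | inj₁ (Cs , unique , all) = contradiction
        (contains-V A X Y (lookup Cs) A∈F X∈F Y∈F
          (proj₁ ∘ proj₂ ∘ C) A⊂X X⊂Y (proj₁ ∘ C)
          (proj₁ ∘ proj₂ ∘ proj₂ ∘ C) (proj₂ ∘ proj₂ ∘ proj₂ ∘ C) (lookup-injective unique _ _))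
        free
    where C = Allᵛ.lookup⁺ all
  ... | inj₂ (l , Cs , l<1+m , all , cover) = begin
    chainSum F? (suc k) A
      ≤⟨ chainSum-⊎ F? (_≟ˢ A) (_∈ᵛ? Bs) (suc k) A split ⟩
    chainSum (_≟ˢ A) (suc k) A + chainSum (_∈ᵛ? Bs) (suc k) A
      ≤⟨ +-mono-≤
           (≤-reflexive (chainSum-maximal (_≟ˢ A) (suc k) eq refl λ A⊂B B≡A → ⊂-irref (sym B≡A) A⊂B))
           (chainSum-∈-≤ eq Bs interior) ⟩
    suc k ! + suc (suc l) * k !
      -- At most m leaves together with `X` and `Y` make at most m + 2 sets, and m + 2 ≤ N =
      -- `suc k`.
      ≤⟨ +-monoʳ-≤ (suc k !) (*-monoˡ-≤ (k !) (≤-trans (s≤s l<1+m) 2+m≤1+k)) ⟩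
    suc k ! + suc k !
      ≡⟨ cong (suc k ! +_) (+-identityʳ _) ⟨
    2 * suc k ! ∎
    where
    open ≤-Reasoning
    Bs = X ∷ Y ∷ Cs
    split : ∀ {B} → A ⊆ B → F B → B ≡ A ⊎ B ∈ᵛ Bs
    split {B} A⊆B B∈F with B ≟ˢ A | B ≟ˢ X | B ≟ˢ Y
    ... | yes B≡A | _       | _       = inj₁ B≡A
    ... | no  _   | yes B≡X | _       = inj₂ (here B≡X)
    ... | no  _   | no  _   | yes B≡Y = inj₂ (there (here B≡Y))
    ... | no  B≢A | no  B≢X | no  B≢Y =
      inj₂ (there (there (cover (⊆∧≢⇒⊂ A⊆B (≢-sym B≢A) , B∈F , B≢X , B≢Y))))
    interior : Allᵛ (λ B → A ⊂ B × ∣ B ∣ < n) Bs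
    interior = (A⊂X , F⇒∣B∣<n X∈F) ∷ (⊂-trans A⊂X X⊂Y , F⇒∣B∣<n Y∈F) ∷
               Allᵛ.map (λ (A⊂B , B∈F , _) → A⊂B , F⇒∣B∣<n B∈F) all
    2+m≤1+k : 2 + m ≤ suc k
    2+m≤1+k = +-cancelˡ-≤ ∣ A ∣ _ _ (begin
      ∣ A ∣ + (2 + m)      ≡⟨ +-assoc ∣ A ∣ 2 m ⟨
      ∣ A ∣ + 2 + m        ≡⟨ cong (_+ m) (+-comm ∣ A ∣ 2) ⟩
      suc (suc ∣ A ∣) + m  ≤⟨ +-monoˡ-≤ m (≤-trans (s≤s (p⊂q⇒∣p∣<∣q∣ A⊂X)) (p⊂q⇒∣p∣<∣q∣ X⊂Y)) ⟩
      ∣ Y ∣ + m            ≤⟨ proj₂ (sizes Y∈F) ⟩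
      n                    ≡⟨ eq ⟨
      ∣ A ∣ + suc k        ∎)

  chainSum-member : ∀ {A} k → ∣ A ∣ + suc k ≡ n → F A → chainSum F? (suc k) A ≤ 2 * suc k !
  chainSum-member {A} k eq A∈F
    with anySubset? (λ X → anySubset? λ Y → F? X ×-dec F? Y ×-dec A ⊂? X ×-dec X ⊂? Y)
  ... | yes (X , Y , X∈F , Y∈F , A⊂X , X⊂Y) = chainSum-above-3-chain k eq A∈F X∈F Y∈F A⊂X X⊂Y
  -- A violation of `Thin 2` is given by members X ⊂ Y ⊂ Z with A ⊆ X. As X may be `A` itself, the
  -- forbidden 3-chain is A ⊂ Y ⊂ Z.
  ... | no ∄chain = chainSum-thin 2 F? (suc k) eq
    λ A⊆X X∈F i∉X {Y} X∪i⊆Y Y∈F j∉Y {Z} Y∪j⊆Z Z∈F →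
      ∄chain (Y , Z , Y∈F , Z∈F , ⊆-⊂-trans A⊆X (p∪⁅x⁆⊆q⇒p⊂q i∉X X∪i⊆Y) , p∪⁅x⁆⊆q⇒p⊂q j∉Y Y∪j⊆Z)

  -- The partition by lowest member, carried out as a recursion: outside `F` the bound passes up to
  -- the covers, and the first member met is settled by `chainSum-member`.
  chainSum-free : ∀ {A} k → ∣ A ∣ + k ≡ n → chainSum F? k A ≤ 2 * k !
  chainSum-free {A} zero    eq = ≤-trans (𝟙≤1 (F? A)) (s≤s z≤n)
  chainSum-free {A} (suc k) eq with toSum (F? A)
  ... | inj₁ A∈F = chainSum-member k eq A∈F
  ... | inj₂ A∉F = begin
    𝟙 (F? A) * suc k ! + ∑⋗ (chainSum F? k) A
      ≡⟨ cong (λ x → x * suc k ! + ∑⋗ (chainSum F? k) A) (𝟙-no (F? A) A∉F) ⟩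
    ∑⋗ (chainSum F? k) A
      ≤⟨ ∑⋗-≤ eq _ (λ i∉A → chainSum-free k (∪⁅⁆-height eq i∉A)) ⟩
    suc k * (2 * k !)
      ≡⟨ x∙yz≈y∙xz (suc k) 2 (k !) ⟩
    2 * suc k ! ∎
    where
    open ≤-Reasoning

-- Clearing denominators in the Lubell function.

lubell-↥ : (F? : Decidable F) → ℚᵘ.↥ lubell F? ℤ.* ℤ.+ 1 ≡ ℤ.+ chainSum F? n (⊥ {n})
lubell-↥ {n = n} F? = trans (ℤ.*-identityʳ _)
  (trans (ℚᵘ.↥[n/d]≡n (ℤ.+ sum (map (count F?) (fullChains n))) (n !) {{n !≢0}})
         (cong ℤ.+_ (chainSum-correct F? n (∣⊥∣+n≡n n))))

lubell-↧ : {F : Family n} (F? : Decidable F) → ∀ c → ℤ.+ c ℤ.* ℚᵘ.↧ lubell F? ≡ ℤ.+ (c * n !)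
lubell-↧ {n = n} F? c = trans
  (cong (ℤ.+ c ℤ.*_) (ℚᵘ.↧[n/d]≡d (ℤ.+ sum (map (count F?) (fullChains n))) (n !) {{n !≢0}}))
  (sym (ℤ.pos-* c (n !)))

lubell≤⁺ : ∀ (F? : Decidable F) c → chainSum F? n (⊥ {n}) ≤ c * n ! → lubell F? ℚᵘ.≤ ℤ.+ c ℚᵘ./ 1
lubell≤⁺ F? c le = ℚᵘ.*≤* (subst₂ ℤ._≤_ (sym (lubell-↥ F?)) (sym (lubell-↧ F? c)) (ℤ.+≤+ le))

lubell≤⁻ : ∀ (F? : Decidable F) c → lubell F? ℚᵘ.≤ ℤ.+ c ℚᵘ./ 1 → chainSum F? n (⊥ {n}) ≤ c * n !
lubell≤⁻ F? c le = ℤ.drop‿+≤+ (subst₂ ℤ._≤_ (lubell-↥ F?) (lubell-↧ F? c) (ℚᵘ.drop-*≤* le))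

-- The extremal example

module _ (p : ℕ) where

  private
    -- `m′` is the m of the theorem and `p` is m - 1, so no truncated subtraction occurs.
    m′ = suc p

  extremal-size : suc (suc p) ≤ m′ + m′
  extremal-size = s≤s (m≤n+m m′ p)

  crown : Subset (m′ + m′)
  crown = proj₁ (∃-of-size (m′ + m′) extremal-size)

  ∣crown∣ : ∣ crown ∣ ≡ suc (suc p)
  ∣crown∣ = proj₂ (∃-of-size (m′ + m′) extremal-size)

  TwoLayers : Family (m′ + m′)
  TwoLayers B = ∣ B ∣ ≡ p ⊎ ∣ B ∣ ≡ suc p

  Extremal : Family (m′ + m′)
  Extremal B = TwoLayers B ⊎ B ≡ crown

  twoLayers? : Decidable TwoLayers
  twoLayers? B = (∣ B ∣ ≟ p) ⊎-dec (∣ B ∣ ≟ suc p)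

  extremal? : Decidable Extremal
  extremal? B = twoLayers? B ⊎-dec (B ≟ˢ crown)

  extremal-≥ : ∀ {B} → Extremal B → p ≤ ∣ B ∣
  extremal-≥ (inj₁ (inj₁ eq)) = ≤-reflexive (sym eq)
  extremal-≥ (inj₁ (inj₂ eq)) = ≤-trans (n≤1+n p) (≤-reflexive (sym eq))
  extremal-≥ (inj₂ refl)      = ≤-trans (m≤n+m p 2) (≤-reflexive (sym ∣crown∣))

  extremal-≤ : ∀ {B} → Extremal B → ∣ B ∣ ≤ 2 + p
  extremal-≤ (inj₁ (inj₁ eq)) = ≤-trans (≤-reflexive eq) (m≤n+m p 2)
  extremal-≤ (inj₁ (inj₂ eq)) = ≤-trans (≤-reflexive eq) (n≤1+n _)
  extremal-≤ (inj₂ refl)      = ≤-reflexive ∣crown∣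

  -- For n = 2m the upper limit n - (m - 1) is m + 1, exactly the size of `crown`.
  extremal-sizes : ∀ {B} → Extremal B → SizesWithin p B
  extremal-sizes {B} B∈ = extremal-≥ B∈ , (begin
    ∣ B ∣ + p    ≤⟨ +-monoˡ-≤ p (extremal-≤ B∈) ⟩
    2 + p + p    ≡⟨ cong suc (+-suc p p) ⟨
    m′ + m′      ∎)
    where open ≤-Reasoning

  extremal-middle : ∀ {B} → Extremal B → p < ∣ B ∣ → B ≢ crown → ∣ B ∣ ≡ suc p
  extremal-middle (inj₁ (inj₁ eq)) p<∣B∣ _       = contradiction (sym eq) (<⇒≢ p<∣B∣)
  extremal-middle (inj₁ (inj₂ eq)) _     _       = eq
  extremal-middle (inj₂ B≡crown)   _     B≢crown = contradiction B≡crown B≢crown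

  extremal-top : ∀ {B} → Extremal B → suc (suc p) ≤ ∣ B ∣ → B ≡ crown
  extremal-top (inj₁ (inj₁ eq)) le = contradiction eq (≢-sym (<⇒≢ (≤-trans (n≤1+n _) le)))
  extremal-top (inj₁ (inj₂ eq)) le = contradiction eq (≢-sym (<⇒≢ le))
  extremal-top (inj₂ B≡crown)   _  = B≡crown

  -- In an embedding the top of the 3-chain is the crown, so the m + 2 nodes
  -- covering the minimum map to m-sets above an (m - 1)-set.  That there are only
  -- m + 1 of these is seen by counting chains instead of sets.
  extremal-free : Free (V (suc m′)) Extremal
  extremal-free emb = <⇒≱ (*-monoˡ-< (m′ !) {{m′ !≢0}} (n<1+n (suc m′))) (begin
    suc (suc m′) * m′ !                        ≤⟨ chainSum-∈-covers eqn Cs unique covers ⟩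
    chainSum (_∈ᵛ? Cs) (suc m′) bot            ≤⟨ chainSum-thin 1 (_∈ᵛ? Cs) (suc m′) eqn thin ⟩
    1 * suc m′ !                               ≡⟨ *-identityˡ (suc m′ !) ⟩
    suc m′ * m′ !                              ∎)
    where
    open ≤-Reasoning
    bot top : Subset (m′ + m′)
    bot = image emb min
    top = image emb (node zero (suc zero))
    -- Index zero gives the middle of the 3-chain and the other indices the m + 1 leaves, m + 2 sets
    -- in all.
    c : Fin (suc (suc m′)) → Subset (m′ + m′)
    c i = image emb (node i (bottom (suc m′) i))
    Cs = Vec.tabulate c
    bot<c : ∀ i → ∣ bot ∣ < ∣ c i ∣
    bot<c i = image-< emb min≤ λ ()
    top≡crown : top ≡ crown
    top≡crown = extremal-top (image∈F emb _)
      -- The sizes along the 3-chain start at m - 1 or more, so its top has size at least m + 1.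
      (<-≤-trans (s≤s (≤-<-trans (extremal-≥ (image∈F emb min)) (min<mid emb))) (mid<top emb))
    low≢top : ∀ i → node {ℓs = 3 ∷ replicate (suc m′) 2} i (bottom (suc m′) i) ≢ node zero (suc zero)
    low≢top zero    ()
    low≢top (suc i) ()
    c≢crown : ∀ i → c i ≢ crown
    c≢crown i ci≡crown = low≢top i (proj₂ (proj₂ emb) (trans ci≡crown (sym top≡crown)))
    ∣c∣ : ∀ i → ∣ c i ∣ ≡ suc p
    ∣c∣ i = extremal-middle (image∈F emb _) (≤-<-trans (extremal-≥ (image∈F emb min)) (bot<c i)) (c≢crown i)
    ∣bot∣ : ∣ bot ∣ ≡ p
    ∣bot∣ = ≤-antisym (≤-pred (≤-trans (bot<c zero) (≤-reflexive (∣c∣ zero)))) (extremal-≥ (image∈F emb min))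
    eqn : ∣ bot ∣ + suc m′ ≡ m′ + m′
    -- `bot` misses m + 1 of the 2m elements, so (m + 1)! chains start there.
    eqn = trans (cong (_+ suc m′) ∣bot∣) (+-suc p m′)
    node-injective : ∀ {i j} →
      node {ℓs = 3 ∷ replicate (suc m′) 2} i (bottom (suc m′) i) ≡ node j (bottom (suc m′) j) → i ≡ j
    node-injective refl = refl
    unique : Unique Cs
    unique = tabulate⁺ λ eq → node-injective (proj₂ (proj₂ emb) eq)
    covers : Allᵛ (λ B → bot ⊆ B × ∣ B ∣ ≡ suc ∣ bot ∣) Cs
    covers = Allᵛ.tabulate⁺ λ i →
      p⊂q⇒p⊆q (image-⊂ emb min≤ λ ()) , trans (∣c∣ i) (cong suc (sym ∣bot∣))
    size : ∀ {B} → B ∈ᵛ Cs → ∣ B ∣ ≡ suc p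
    size = Allᵛ.lookup (Allᵛ.tabulate⁺ {P = λ B → ∣ B ∣ ≡ suc p} {f = c} ∣c∣)
    -- Sets of equal size form an antichain, so a chain meets at most one of them.
    thin : Thin 1 (_∈ᵛ Cs) bot
    thin {B} {i} _ B∈ i∉B {D} B∪i⊆D D∈ = <⇒≢
      (≤-trans (≤-reflexive (sym (∣p∪⁅x⁆∣≡1+∣p∣ B i∉B))) (p⊆q⇒∣p∣≤∣q∣ B∪i⊆D))
      (trans (size B∈) (sym (size D∈)))

  -- The two full layers already meet every chain twice, and at least one chain also passes through
  -- `crown`.
  extremal-lubell : ¬ lubell extremal? ℚᵘ.≤ ℤ.+ 2 ℚᵘ./ 1
  extremal-lubell le = <⇒≱ (begin-strict
    2 * N !
      ≡⟨ cong (N ! +_) (+-identityʳ (N !)) ⟩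
    N ! + N !
      <⟨ m<m+n (N ! + N !) crown-sum ⟩
    N ! + N ! + chainSum (_≟ˢ crown) N ⊥
      ≡⟨ cong (_+ chainSum (_≟ˢ crown) N ⊥)
           (cong₂ _+_ (chainSum-layer-⊥ (m≤n⇒m≤1+n (m≤m+n p m′))) (chainSum-layer-⊥ (m≤m+n m′ m′))) ⟨
    chainSum (layer? p) N ⊥ + chainSum (layer? m′) N ⊥ + chainSum (_≟ˢ crown) N ⊥
      ≤⟨ +-monoˡ-≤ _ (chainSum-disjoint twoLayers? (layer? p) (layer? m′) N ⊥
           (λ _ → inj₁) (λ _ → inj₂) (λ _ eq eq′ → <⇒≢ (n<1+n p) (trans (sym eq) eq′))) ⟩
    chainSum twoLayers? N ⊥ + chainSum (_≟ˢ crown) N ⊥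
      ≤⟨ chainSum-disjoint extremal? twoLayers? (_≟ˢ crown) N ⊥ (λ _ → inj₁) (λ _ → inj₂)
           (λ { _ B∈ refl → crown∉TwoLayers B∈ }) ⟩
    chainSum extremal? N ⊥ ∎)
    (lubell≤⁻ extremal? 2 le)
    where
    open ≤-Reasoning
    N = m′ + m′
    layer? : ∀ j → Decidable (λ (B : Subset N) → ∣ B ∣ ≡ j)
    layer? j B = ∣ B ∣ ≟ j
    crown∉TwoLayers : ¬ TwoLayers crown
    crown∉TwoLayers (inj₁ eq) = <⇒≢ (m≤n+m (suc p) 1) (trans (sym eq) ∣crown∣)
    crown∉TwoLayers (inj₂ eq) = <⇒≢ (n<1+n (suc p)) (trans (sym eq) ∣crown∣)
    crown-sum : 0 < chainSum (_≟ˢ crown) N ⊥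
    crown-sum = subst (0 <_) (sym (chainSum-singleton-⊥ crown))
      (*-mono-≤ (1≤n! ∣ crown ∣) (1≤n! (N ∸ ∣ crown ∣)))

theorem5p3 : ∀ (m : ℕ) → 1 ≤ m →
    let P = fan (3 ∷ replicate (suc m) 2) in
    (m -L-Bounded P) × ¬ ((m ∸ 1) -L-Bounded P)
theorem5p3 m@(suc p) 1≤m =
  (2 , (layers-free (suc m) , e[V]≤2 m) , λ n F F? sizes free →
     lubell≤⁺ F? 2 (chainSum-free F? 1≤m sizes free n (∣⊥∣+n≡n n))) ,
  -- Boundedness comes with its own value `k` of e; `e[V]≤2` gives k ≤ 2, so its bound is weakened
  -- to 2.
  λ (k , (free , _) , bounded) → extremal-lubell p (ℚᵘ.≤-trans
    (bounded (m + m) (Extremal p) (extremal? p) (extremal-sizes p) (extremal-free p))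
    (ℚᵘ.*≤* (ℤ.*-monoʳ-≤-nonNeg (ℤ.+ 1) (ℤ.+≤+ (e[V]≤2 m k free)))))
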